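{- Let $\mathcal T$ be an M-template of minimal Taylor algebras and $P=(V,D,\mathcal C)$, $D=\{\mathbf A_i:i\in V\}$, an SI-instance of $CSP(\mathcal T)$. Let $P/\overline{\mu}$ be the instance obtained from $P$ by factoring every large centralizer domain $\mathbf A_i$ by its monolith congruence $\mu_i$, and leaving all other domains of variables unchanged. Suppose that for every $i\in V$ and every point $a$ in the domain of $i$ in $P/\overline{\mu}$ (so $a$ is a $\mu_i$-class if $\mathbf A_i$ is a large centralizer domain, and an element of $A_i$ otherwise), $P/\overline{\mu}$ has a solution $f_a$ such that $f_a(i)=a$. Then there exists a retractive consistent set of maps $\{p_i:i\in V\}$ for $P$ such that each large centralizer domain $\mathbf A_i$ which has an s-edge is mapped onto a proper retract, i.e. $p_i(A_i)\subsetneq A_i$. In particular, if $\mathcal T$ is an M-template of minimal Taylor algebras, $P=(V,D,\mathcal C)$ is an SI-instance of $CSP(\mathcal T)$ such that for every $j\in V$ and every point $a$ in the domain of $j$ in $P/\overline{\mu}$ the instance $P/\overline{\mu}$ has a solution $f_a$ with $f_a(j)=a$, and if $\mathbf A_i$ is a large centralizer domain of $P$ and $\mathbf B_i\lhd_2\mathbf A_i$, then $P$ has a solution iff $P$ has a solution $f$ such that $f(i)\in B_i$.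
   Context: All algebras are finite and idempotent. A Taylor term is an idempotent term satisfying a finite set of equations not satisfied by any projection on a set with more than one element. A finite algebra $\mathbf A$ is minimal Taylor if it has a Taylor term and each Taylor term operation of $\mathbf A$ generates the whole clone of term operations of $\mathbf A$. An M-template is a class $\mathcal T$ of isomorphism types of similar finite algebras closed under homomorphic images, subalgebras and unary polynomial retracts (for a unary polynomial $p$ of $\mathbf A$ with $p\circ p=p$, the retract $p(\mathbf A)$ has universe $p(A)$ and operations $p\circ f$ restricted to $p(A)$, $f$ a basic operation of $\mathbf A$). A (multisorted) instance of $CSP(\mathcal T)$ is a triple $P=(V,D,\mathcal C)$, where $V$ is a finite set of variables, $D=\{\mathbf A_i:i\in V\}$ with each domain $\mathbf A_i$ isomorphic to an algebra in $\mathcal T$, and $\mathcal C$ is a set of constraints $(S,R)$ with $S\subseteq V$ and $R\le\prod_{i\in S}\mathbf A_i$ a subdirect product. A solution is $f\in\prod_{i\in V}A_i$ with $f|_S\in R$ for every $(S,R)\in\mathcal C$. An SI-instance is one in which every domain $\mathbf A_i$ is subdirectly irreducible; $\mu_i$ is its monolith (least nonzero congruence). Factoring a domain replaces $\mathbf A_i$ by $\mathbf A_i/\mu_i$ and each constraint relation by its image under the corresponding coordinatewise quotient maps. For congruences, the centralizer condition $C(\alpha,\beta;\delta)$ holds if for every term $t(\bar x,\bar y)$ and all tuples $\bar a,\bar b,\bar c,\bar d$ with $a_k\mathrel{\alpha}b_k$ and $c_k\mathrel{\beta}d_k$ for all $k$: $t(\bar a,\bar c)\mathrel{\delta}t(\bar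 a,\bar d)$ implies $t(\bar b,\bar c)\mathrel{\delta}t(\bar b,\bar d)$. The domain $\mathbf A_i$ is a large centralizer domain if $C(1_{\mathbf A_i},\mu_i;0_{\mathbf A_i})$ holds, where $1$ and $0$ denote the full and the equality congruence. A set of maps $\{p_i:i\in V\}$ is consistent with $P$ if each $p_i$ is a unary polynomial of $\mathbf A_i$ and for every constraint $(S,R)$ and every $r\in R$, $\langle p_i(r_i):i\in S\rangle\in R$. It is retractive if $p_i\circ p_i=p_i$ for all $i\in V$. $\mathbf A$ has an s-edge if there are $a\ne b$ in $A$ with $a\rightarrow_s b$, i.e. there is a binary term $t$ acting on $\{a,b\}$ as a semilattice operation with absorbing element $b$. $\mathbf B\lhd_2\mathbf A$ means that $\mathbf B$ is a (nonempty) subalgebra of $\mathbf A$ and there is a binary term operation $t$ of $\mathbf A$ with $t(x,y)\in B$ whenever $x,y\in A$ and at least one of $x,y$ is in $B$. -}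

module Defs where

open import Data.Fin.Base using (Fin)
import Data.Fin.Subset as Subset
open import Data.List.Base as List using (List)
open import Data.List.Relation.Unary.All using (All)
open import Data.Nat.Base using (ℕ; suc)
open import Data.Product.Base using (Σ; Σ-syntax; ∃; ∃-syntax; _×_; _,_; proj₁; proj₂)
open import Data.Sum.Base using (_⊎_; inj₁; inj₂; [_,_]′)
open import Data.Unit.Base using (⊤; tt)
open import Data.Vec.Functional using (Vector; []; _∷_)
open import Function.Base using (_∘_)
open import Function.Bundles using (Injection; Surjection; Inverse)
open import Level using (Level; 0ℓ; _⊔_) renaming (suc to lsuc)
open import Relation.Binary.Bundles using (Setoid)
open import Relation.Binary.Core using (Rel; _⇒_)
open import Relation.Binary.Definitions using (_Respects_)
open import Relation.Binary.PropositionalEquality as ≡ using (_≡_; _≢_)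
open import Relation.Binary.Structures using (IsEquivalence)
open import Relation.Nullary.Negation using (¬_)
open import Relation.Unary using (Pred; Decidable; Satisfiable; _∈_)

------------------------------------------------------------------------
-- Algebras and terms

record Signature : Set₁ where
  field
    Op    : Set
    arity : Op → ℕ

open Signature

data Term (σ : Signature) (X : Set) : Set where
  var : X → Term σ X
  app : (f : Op σ) → Vector (Term σ X) (arity σ f) → Term σ X

-- Carriers are setoids, so that a quotient keeps the carrier and only
-- coarsens the equality.

record Algebra (σ : Signature) : Set₁ where
  field
    domain      : Setoid 0ℓ 0ℓ
  open Setoid domain public
  field
    interp      : (f : Op σ) → Vector Carrier (arity σ f) → Carrier
    interp-cong : ∀ f {xs ys} → (∀ k → xs k ≈ ys k) → interp f xs ≈ interp f ys

open Algebra using (Carrier; domain; interp)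

module _ {σ : Signature} (A : Algebra σ) where
  open Algebra A using (_≈_; refl; interp-cong)

  eval : {X : Set} → Term σ X → (X → Carrier A) → Carrier A
  eval (var x)    ρ = ρ x
  eval (app f ts) ρ = interp A f (λ k → eval (ts k) ρ)

  eval-cong : {X : Set} (t : Term σ X) {ρ ρ′ : X → Carrier A} →
              (∀ x → ρ x ≈ ρ′ x) → eval t ρ ≈ eval t ρ′
  eval-cong (var x)    e = e x
  eval-cong (app f ts) e = interp-cong f (λ k → eval-cong (ts k) e)

  binary : Term σ (Fin 2) → Carrier A → Carrier A → Carrier A
  binary t x y = eval t (x ∷ y ∷ [])

  Idempotent : Set
  Idempotent = ∀ f x → interp A f (λ _ → x) ≈ x

record FiniteAlgebra (σ : Signature) : Set₁ where
  field
    algebra     : Algebra σ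
    nonempty    : Carrier algebra
    size        : ℕ
    enumeration : Inverse (domain algebra) (≡.setoid (Fin size))
    idempotent  : Idempotent algebra

open FiniteAlgebra using (algebra)

Product : {σ : Signature} {I : Set} → (I → Algebra σ) → Algebra σ
Product {I = I} A = record
  { domain = record
    { Carrier       = (i : I) → Carrier (A i)
    ; _≈_           = λ x y → ∀ i → Algebra._≈_ (A i) (x i) (y i)
    ; isEquivalence = record
      { refl  = λ i → Algebra.refl (A i)
      ; sym   = λ e i → Algebra.sym (A i) (e i)
      ; trans = λ e e′ i → Algebra.trans (A i) (e i) (e′ i)
      }
    }
  ; interp      = λ f xs i → interp (A i) f (λ k → xs k i)
  ; interp-cong = λ f e i → Algebra.interp-cong (A i) f (λ k → e k i)
  }

record IsSubuniverse {σ : Signature} (A : Algebra σ) (B : Pred (Carrier A) 0ℓ) : Set where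
  field
    respects : B Respects Algebra._≈_ A
    nonempty : Satisfiable B
    closed   : ∀ f xs → (∀ k → xs k ∈ B) → interp A f xs ∈ B

module _ {σ : Signature} (A B : Algebra σ) where
  open Algebra B using (_≈_)

  Preserves : (Carrier A → Carrier B) → Set
  Preserves h = ∀ f xs → h (interp A f xs) ≈ interp B f (h ∘ xs)

  _≅_ : Set
  _≅_ = Σ[ h ∈ Inverse (domain A) (domain B) ] Preserves (Inverse.to h)

  _EmbedsInto_ : Set
  _EmbedsInto_ = Σ[ h ∈ Injection (domain A) (domain B) ] Preserves (Injection.to h)

  _MapsOnto_ : Set
  _MapsOnto_ = Σ[ h ∈ Surjection (domain A) (domain B) ] Preserves (Surjection.to h)

------------------------------------------------------------------------
-- Unary polynomials and their retracts

module _ {σ : Signature} (A : Algebra σ) where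
  open Algebra A using (_≈_; refl; sym; trans; interp-cong)

  IsUnaryPolynomial : (Carrier A → Carrier A) → Set
  IsUnaryPolynomial p =
    ∃[ n ] Σ[ t ∈ Term σ (Fin (suc n)) ] Σ[ c ∈ Vector (Carrier A) n ]
      (∀ x → p x ≈ eval A t (x ∷ c))

  polynomial-cong : ∀ {p} → IsUnaryPolynomial p → ∀ {x y} → x ≈ y → p x ≈ p y
  polynomial-cong (n , t , c , e) {x} {y} x≈y =
    trans (e x) (trans (eval-cong A t pointwise) (sym (e y)))
    where
    pointwise : ∀ k → (x ∷ c) k ≈ (y ∷ c) k
    pointwise Fin.zero    = x≈y
    pointwise (Fin.suc k) = refl

  IdempotentMap : (Carrier A → Carrier A) → Set
  IdempotentMap p = ∀ x → p (p x) ≈ p x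

  InImage : (Carrier A → Carrier A) → Pred (Carrier A) 0ℓ
  InImage p y = ∃[ x ] p x ≈ y

  Retract : (p : Carrier A → Carrier A) → IsUnaryPolynomial p → Algebra σ
  Retract p poly = record
    { domain = record
      { Carrier       = ∃ (InImage p)
      ; _≈_           = λ x y → proj₁ x ≈ proj₁ y
      ; isEquivalence = record { refl = refl ; sym = sym ; trans = trans }
      }
    ; interp      = λ f xs → let y = interp A f (proj₁ ∘ xs) in p y , y , refl
    ; interp-cong = λ f e → polynomial-cong poly (interp-cong f e)
    }

------------------------------------------------------------------------
-- Congruences

record Congruence {σ : Signature} (A : Algebra σ) : Set₁ where
  open Algebra A using (_≈_)
  field
    _∼_           : Rel (Carrier A) 0ℓ
    isEquivalence : IsEquivalence _∼_
    reflexive     : _≈_ ⇒ _∼_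
    compatible    : ∀ f {xs ys} → (∀ k → xs k ∼ ys k) → interp A f xs ∼ interp A f ys

open Congruence using (_∼_)

module _ {σ : Signature} (A : Algebra σ) where
  open Algebra A using (_≈_)

  fullCongruence : Congruence A
  fullCongruence = record
    { _∼_           = λ _ _ → ⊤
    ; isEquivalence = record { refl = tt ; sym = λ _ → tt ; trans = λ _ _ → tt }
    ; reflexive     = λ _ → tt
    ; compatible    = λ _ _ → tt
    }

  equalityCongruence : Congruence A
  equalityCongruence = record
    { _∼_           = _≈_
    ; isEquivalence = Algebra.isEquivalence A
    ; reflexive     = λ e → e
    ; compatible    = Algebra.interp-cong A
    }

  Nonzero : Congruence A → Set
  Nonzero θ = ∃[ a ] ∃[ b ] _∼_ θ a b × ¬ (a ≈ b)

  record SubdirectlyIrreducible : Set₁ where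
    field
      monolith : Congruence A
      nonzero  : Nonzero monolith
      least    : (θ : Congruence A) → Nonzero θ → _∼_ monolith ⇒ _∼_ θ

  Quotient : Congruence A → Algebra σ
  Quotient θ = record
    { domain      = record { isEquivalence = Congruence.isEquivalence θ }
    ; interp      = interp A
    ; interp-cong = Congruence.compatible θ
    }

  Centralizes : (α β δ : Congruence A) → Set
  Centralizes α β δ =
    ∀ {m n} (t : Term σ (Fin m ⊎ Fin n)) (a b : Vector (Carrier A) m) (c d : Vector (Carrier A) n) →
    (∀ k → _∼_ α (a k) (b k)) → (∀ k → _∼_ β (c k) (d k)) →
    _∼_ δ (eval A t [ a , c ]′) (eval A t [ a , d ]′) →
    _∼_ δ (eval A t [ b , c ]′) (eval A t [ b , d ]′)

open SubdirectlyIrreducible using (monolith)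

LargeCentralizer : {σ : Signature} {A : Algebra σ} → SubdirectlyIrreducible A → Set
LargeCentralizer {A = A} si =
  Centralizes A (fullCongruence A) (monolith si) (equalityCongruence A)

-- The congruence by which a domain is factored: the monolith for a large
-- centralizer domain, equality otherwise.  The disjunction avoids having
-- to decide which case applies.

factorCongruence : {σ : Signature} {A : Algebra σ} → SubdirectlyIrreducible A → Congruence A
factorCongruence {A = A} si = record
  { _∼_           = _≋_
  ; isEquivalence = record { refl = inj₁ refl ; sym = ≋-sym ; trans = ≋-trans }
  ; reflexive     = inj₁
  ; compatible    = λ f e → ≋-compatible f e
  }
  where
  open Algebra A using (_≈_; refl; sym; trans; interp-cong)
  module μ = Congruence (monolith si)
  module μ-eq = IsEquivalence μ.isEquivalence

  _≋_ : Rel (Carrier A) 0ℓ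
  x ≋ y = x ≈ y ⊎ (LargeCentralizer si × x μ.∼ y)

  ≋-sym : ∀ {x y} → x ≋ y → y ≋ x
  ≋-sym (inj₁ e)       = inj₁ (sym e)
  ≋-sym (inj₂ (l , e)) = inj₂ (l , μ-eq.sym e)

  ≋-trans : ∀ {x y z} → x ≋ y → y ≋ z → x ≋ z
  ≋-trans (inj₁ e)       (inj₁ e′)       = inj₁ (trans e e′)
  ≋-trans (inj₁ e)       (inj₂ (l , e′)) = inj₂ (l , μ-eq.trans (μ.reflexive e) e′)
  ≋-trans (inj₂ (l , e)) (inj₁ e′)       = inj₂ (l , μ-eq.trans e (μ.reflexive e′))
  ≋-trans (inj₂ (l , e)) (inj₂ (_ , e′)) = inj₂ (l , μ-eq.trans e e′)

  allEqualOrLarge : ∀ n {xs ys : Vector (Carrier A) n} →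
    (∀ k → xs k ≋ ys k) → (∀ k → xs k ≈ ys k) ⊎ LargeCentralizer si
  allEqualOrLarge 0       e = inj₁ λ ()
  allEqualOrLarge (suc n) e with e Fin.zero | allEqualOrLarge n (e ∘ Fin.suc)
  ... | inj₂ (l , _) | _       = inj₂ l
  ... | inj₁ _       | inj₂ l  = inj₂ l
  ... | inj₁ e₀      | inj₁ es = inj₁ λ { Fin.zero → e₀ ; (Fin.suc k) → es k }

  ≋⇒μ : ∀ {x y} → x ≋ y → x μ.∼ y
  ≋⇒μ (inj₁ e)       = μ.reflexive e
  ≋⇒μ (inj₂ (_ , e)) = e

  ≋-compatible : ∀ f {xs ys} → (∀ k → xs k ≋ ys k) → interp A f xs ≋ interp A f ys
  ≋-compatible f e with allEqualOrLarge _ e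
  ... | inj₁ es = inj₁ (interp-cong f es)
  ... | inj₂ l  = inj₂ (l , μ.compatible f (≋⇒μ ∘ e))

------------------------------------------------------------------------
-- Minimal Taylor algebras

Equation : Signature → Set
Equation σ = Term σ ℕ × Term σ ℕ

_⊨_ : {σ : Signature} → Algebra σ → List (Equation σ) → Set
A ⊨ E = All (λ (l , r) → ∀ ρ → Algebra._≈_ A (eval A l ρ) (eval A r ρ)) E

oneOperation : ℕ → Signature
oneOperation n = record { Op = ⊤ ; arity = λ _ → n }

projectionAlgebra : (X : Set) {n : ℕ} → Fin n → Algebra (oneOperation n)
projectionAlgebra X k = record
  { domain      = ≡.setoid X
  ; interp      = λ _ xs → xs k
  ; interp-cong = λ _ e → e k
  }

module _ {σ : Signature} (A : Algebra σ) where
  open Algebra A using (_≈_)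

  termReduct : ∀ {n} → Term σ (Fin n) → Algebra (oneOperation n)
  termReduct t = record
    { domain      = domain A
    ; interp      = λ _ → eval A t
    ; interp-cong = λ _ → eval-cong A t
    }

  record IsTaylorTerm {n : ℕ} (t : Term σ (Fin n)) : Set₁ where
    field
      idempotent    : ∀ x → eval A t (λ _ → x) ≈ x
      equations     : List (Equation (oneOperation n))
      satisfied     : termReduct t ⊨ equations
      notProjection : (X : Set) → (Σ[ x ∈ X ] ∃[ y ] x ≢ y) →
                      (k : Fin n) → ¬ (projectionAlgebra X k ⊨ equations)

  GeneratesClone : ∀ {n} → Term σ (Fin n) → Set
  GeneratesClone {n} t =
    ∀ {m} (s : Term σ (Fin m)) → Σ[ u ∈ Term (oneOperation n) (Fin m) ]
      (∀ ρ → eval (termReduct t) u ρ ≈ eval A s ρ)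

  record MinimalTaylor : Set₁ where
    field
      hasTaylorTerm : ∃[ n ] Σ[ t ∈ Term σ (Fin n) ] IsTaylorTerm t
      minimal       : ∀ {n} (t : Term σ (Fin n)) → IsTaylorTerm t → GeneratesClone t

------------------------------------------------------------------------
-- Semilattice edges and binary absorption

  record _⟶ₛ_ (a b : Carrier A) : Set where
    field
      term : Term σ (Fin 2)
      aa   : binary A term a a ≈ a
      ab   : binary A term a b ≈ b
      ba   : binary A term b a ≈ b
      bb   : binary A term b b ≈ b

  HasSEdge : Set
  HasSEdge = ∃[ a ] ∃[ b ] ¬ (a ≈ b) × (a ⟶ₛ b)

  record BinaryAbsorbing (B : Pred (Carrier A) 0ℓ) : Set where
    field
      isSubuniverse : IsSubuniverse A B
      term          : Term σ (Fin 2)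
      absorbs       : ∀ x y → x ∈ B ⊎ y ∈ B → binary A term x y ∈ B

------------------------------------------------------------------------
-- Templates.  Invariance of T under isomorphism is not a separate field: an
-- isomorphic copy is in particular a homomorphic image.

record IsMTemplate {σ : Signature} {ℓ : Level} (T : Pred (FiniteAlgebra σ) ℓ) : Set (lsuc 0ℓ ⊔ ℓ) where
  field
    homomorphicImages : ∀ {A B} → A ∈ T → algebra A MapsOnto algebra B → B ∈ T
    subalgebras       : ∀ {A B} → A ∈ T → algebra B EmbedsInto algebra A → B ∈ T
    retracts          : ∀ {A B} → A ∈ T →
                        ∀ p (poly : IsUnaryPolynomial (algebra A) p) → IdempotentMap (algebra A) p →
                        algebra B ≅ Retract (algebra A) p poly → B ∈ T

------------------------------------------------------------------------
-- Multisorted instances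

module _ {σ : Signature} {n : ℕ} (D : Fin n → Algebra σ) where

  Scoped : Subset.Subset n → Algebra σ
  Scoped S = Product {I = Σ[ i ∈ Fin n ] i Subset.∈ S} (D ∘ proj₁)

  record Constraint : Set₁ where
    field
      scope         : Subset.Subset n
      relation      : Pred (Carrier (Scoped scope)) 0ℓ
      isSubuniverse : IsSubuniverse (Scoped scope) relation
      subdirect     : ∀ i a → ∃[ r ] r ∈ relation × Algebra._≈_ (D (proj₁ i)) (r i) a

record Instance (σ : Signature) : Set₁ where
  field
    variables   : ℕ
    dom         : Fin variables → Algebra σ
    constraints : List (Constraint dom)

module _ {σ : Signature} (P : Instance σ) where
  open Instance P

  Solution : Pred (∀ i → Carrier (dom i)) (lsuc 0ℓ)
  Solution f = All (λ C → (f ∘ proj₁) ∈ Constraint.relation C) constraints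

  SolutionThroughEveryPoint : Set₁
  SolutionThroughEveryPoint =
    ∀ i a → ∃[ f ] f ∈ Solution × Algebra._≈_ (dom i) (f i) a

  SIInstance : Set₁
  SIInstance = ∀ i → SubdirectlyIrreducible (dom i)

  record Consistent (p : ∀ i → Carrier (dom i) → Carrier (dom i)) : Set₁ where
    field
      polynomial : ∀ i → IsUnaryPolynomial (dom i) (p i)
      preserves  : All (λ C → let R = Constraint.relation C in
                         ∀ r → r ∈ R → (λ i → p (proj₁ i) (r i)) ∈ R) constraints

  Retractive : (∀ i → Carrier (dom i) → Carrier (dom i)) → Set
  Retractive p = ∀ i → IdempotentMap (dom i) (p i)

-- Relations on finite products are taken decidable, the constructive form
-- of a subset of a finite set.

record _IsInstanceOfCSP_ {σ : Signature} {ℓ : Level} (P : Instance σ)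
                         (T : Pred (FiniteAlgebra σ) ℓ) : Set (lsuc 0ℓ ⊔ ℓ) where
  open Instance P
  field
    domains   : ∀ i → ∃[ A ] A ∈ T × dom i ≅ algebra A
    relations : All (λ C → Decidable (Constraint.relation C)) constraints

module _ {σ : Signature} {n : ℕ} {D : Fin n → Algebra σ} (θ : ∀ i → Congruence (D i)) where

  factorConstraint : Constraint D → Constraint (λ i → Quotient (D i) (θ i))
  factorConstraint C = record
    { scope         = scope
    ; relation      = image
    ; isSubuniverse = record
      { respects = λ { e (r , r∈R , rθs) →
          r , r∈R , λ i → IsEquivalence.trans (Congruence.isEquivalence (θ (proj₁ i))) (rθs i) (e i) }
      ; nonempty = let r , r∈R = IsSubuniverse.nonempty isSubuniverse in
          r , r , r∈R , λ i → IsEquivalence.refl (Congruence.isEquivalence (θ (proj₁ i)))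
      ; closed   = λ f ss h →
          interp (Scoped D scope) f (proj₁ ∘ h) ,
          IsSubuniverse.closed isSubuniverse f (proj₁ ∘ h) (λ k → proj₁ (proj₂ (h k))) ,
          λ i → Congruence.compatible (θ (proj₁ i)) f (λ k → proj₂ (proj₂ (h k)) i)
      }
    ; subdirect     = λ i a → let r , r∈R , e = subdirect i a in
        r ,
        (r , r∈R , λ j → IsEquivalence.refl (Congruence.isEquivalence (θ (proj₁ j)))) ,
        Congruence.reflexive (θ (proj₁ i)) e
    }
    where
    open Constraint C

    image : Pred (Carrier (Scoped D scope)) 0ℓ
    image s = ∃[ r ] r ∈ relation × (∀ i → _∼_ (θ (proj₁ i)) (r i) (s i))

factorInstance : {σ : Signature} (P : Instance σ) →
                 (∀ i → Congruence (Instance.dom P i)) → Instance σ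
factorInstance P θ = record
  { variables   = Instance.variables P
  ; dom         = λ i → Quotient (Instance.dom P i) (θ i)
  ; constraints = List.map (factorConstraint θ) (Instance.constraints P)
  }

infix 8 _/μ̄_
_/μ̄_ : {σ : Signature} (P : Instance σ) → SIInstance P → Instance σ
P /μ̄ si = factorInstance P (λ i → factorCongruence (si i))

{-# OPTIONS --safe #-}
module Submission where

-- Given a binary term t, let u be the term t(x, t(x, … t(x, y))) with N ! occurrences
-- of t, where N bounds the sizes of all domains, so that u(x, u(x, y)) = u(x, y).  On
-- a large centralizer domain with monolith μ this forces u(y, u(x, y)) = y whenever
-- x μ y, hence s(x, y) = u(x, u(y, x)) is the first projection on every μ-class.
-- Centrality then shows that s(x, c) depends only on the μ-class of c, so for every
-- solution f of P/μ̄ the maps x ↦ s(x, f(i)) form a consistent set for P.  If t is a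
-- semilattice operation on an s-edge a → b, then so is s, and a solution with f(i) = b
-- gives a map collapsing a and b; if t witnesses that B absorbs, then so does s, and a
-- solution through a point of B gives a map into B.  Iterating makes the maps
-- retractive.  To know constructively which domains have an s-edge, one uses that the
-- clone is generated by a single term: s-edges are then found by computing
-- subalgebras of the square.

open import Defs
open import Data.Fin.Base using (Fin; zero; suc; toℕ; _↑ˡ_; _↑ʳ_; combine; funToFin; finToFun)
open import Data.Fin.Properties as Fin using (any?; all?; pigeonhole; toℕ<n; finToFun-funToFin; funToFin-finToFin)
open import Data.Fin.Subset as Subset using (Subset; ⁅_⁆; _∪_)
open import Data.Fin.Subset.Induction using (⊃-wellFounded; Acc; acc)
open import Data.Fin.Subset.Properties as Subset using (_∈?_; p⊆p∪q; q⊆p∪q; x∈p∪q⁻; x∈⁅x⁆; x∈⁅y⁆⇒x≡y; ∉⊥)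
open import Data.List.Base as List using (allFin)
open import Data.List.Membership.Propositional.Properties using (∈-allFin)
open import Data.List.Relation.Unary.All as All using (All)
import Data.List.Relation.Unary.All.Properties as All
open import Data.Nat.Base using (ℕ; zero; suc; _+_; _*_; _∸_; _⊔_; _≤_; _^_; _!; NonZero; >-nonZero; z≤n; s≤s)
open import Data.Nat.Divisibility using (_∣_; divides; ∣-trans; ∣⇒≤; m≤n⇒m!∣n!; m∣m*n)
open import Data.Nat.GeneralisedArithmetic using (fold; fold-+)
open import Data.Nat.Properties as ℕ using (_!≢0; ≤-refl; ≤-trans; <⇒≤)
open import Data.Product.Base using (Σ-syntax; _×_; _,_; ∃-syntax; proj₁; proj₂)
open import Data.Sum.Base using (_⊎_; inj₁; inj₂; [_,_]′; swap)
open import Data.Unit.Base using (⊤; tt)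
open import Data.Vec.Functional as Vector using ([]; _∷_)
open import Data.Vec.Functional.Properties using (lookup-++ˡ; lookup-++ʳ)
open import Function.Base using (_∘_; id)
open import Function.Bundles using (Inverse; _⇔_; mk⇔)
import Function.Construct.Composition as Composition
import Function.Construct.Symmetry as Symmetry
open import Level using (Level; 0ℓ)
open import Relation.Binary.Bundles using (Setoid)
open import Relation.Binary.PropositionalEquality as ≡ using (_≡_)
open import Relation.Binary.Structures using (IsEquivalence)
import Relation.Binary.Reasoning.Setoid as SetoidReasoning
open import Relation.Nullary.Decidable as Dec using (Dec; yes; no; ¬?; _×-dec_; _⊎-dec_; decidable-stable)
open import Relation.Nullary.Negation using (¬_; contradiction)
open import Relation.Unary using (Pred; Decidable; _∈_)

open Algebra using (Carrier; domain; interp)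

-- Finite setoids and periodicity of iterated self-maps

to-injective : {S T : Setoid 0ℓ 0ℓ} (h : Inverse S T) → ∀ {x y} →
               Setoid._≈_ T (Inverse.to h x) (Inverse.to h y) → Setoid._≈_ S x y
to-injective {S} h {x} {y} e =
  trans (sym (strictlyInverseʳ x)) (trans (from-cong e) (strictlyInverseʳ y))
  where
  open Setoid S
  open Inverse h

IsFinite : Setoid 0ℓ 0ℓ → ℕ → Set
IsFinite S n = Inverse S (≡.setoid (Fin n))

module _ {S : Setoid 0ℓ 0ℓ} {n : ℕ} (finite : IsFinite S n) where
  open Setoid S renaming (Carrier to X)
  open Inverse finite using (to; from; to-cong; from-cong; strictlyInverseʳ)

  finite-≟ : ∀ x y → Dec (x ≈ y)
  finite-≟ x y = Dec.map′ (to-injective finite) to-cong (to x Fin.≟ to y)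

  -- Among x, g x, …, gⁿ x two agree, so the orbit becomes periodic after fewer than
  -- n steps, with a period at most n; hence N ! is both late enough and a multiple
  -- of the period.
  fold-!-idempotent : ∀ {N} → n ≤ N → (g : X → X) → (∀ {x y} → x ≈ y → g x ≈ g y) →
                      ∀ x → fold (fold x g (N !)) g (N !) ≈ fold x g (N !)
  fold-!-idempotent {N} n≤N g g-cong x
    with pigeonhole ≤-refl (λ (k : Fin (suc n)) → to (fold x g (toℕ k)))
  ... | i , j , i<j , collision =
    -- The nested folds merge into one of length `N ! + N !`. One summand is dropped as a multiple
    -- of the period `d`; the other lies past the start of the periodic part.
    trans (reflexive (≡.sym (fold-+ x g (N !)))) (at-multiple (divides-! d d≤N) i≤N!)
    where
    d = toℕ j ∸ toℕ i

    shift : ∀ m → fold x g (m + toℕ i) ≈ fold x g (m + toℕ j)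
    shift zero    = to-injective finite collision
    shift (suc m) = g-cong (shift m)

    j≤n : toℕ j ≤ n
    j≤n with toℕ<n j
    ... | s≤s j≤n = j≤n

    instance
      d≢0 : NonZero d
      d≢0 = >-nonZero (ℕ.m<n⇒0<n∸m i<j)

    d≤N : d ≤ N
    d≤N = ≤-trans (ℕ.m∸n≤m (toℕ j) (toℕ i)) (≤-trans j≤n n≤N)

    divides-! : ∀ m .{{_ : NonZero m}} → m ≤ N → m ∣ N !
    divides-! (suc m) m≤N = ∣-trans (m∣m*n (m !)) (m≤n⇒m!∣n! m≤N)

    -- `toℕ j` is positive and at most `N`, hence a divisor of `N !`, and `toℕ i` lies below it.
    i≤N! : toℕ i ≤ N !
    i≤N! = ≤-trans (<⇒≤ i<j) (∣⇒≤ {{N !≢0}} (divides-! (toℕ j) {{>-nonZero (ℕ.≤-<-trans z≤n i<j)}} (≤-trans j≤n n≤N)))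

    one-period : ∀ {e} → toℕ i ≤ e → fold x g (d + e) ≈ fold x g e
    one-period {e} i≤e = begin
      fold x g (d + e)                ≡⟨ ≡.cong (fold x g) d+e ⟩
      fold x g (e ∸ toℕ i + toℕ j)    ≈⟨ shift (e ∸ toℕ i) ⟨
      fold x g (e ∸ toℕ i + toℕ i)    ≡⟨ ≡.cong (fold x g) (ℕ.m∸n+n≡m i≤e) ⟩
      fold x g e                      ∎
      where
      open SetoidReasoning S
      d+e : d + e ≡ e ∸ toℕ i + toℕ j
      d+e = ≡.trans (ℕ.+-comm d e) (≡.trans (≡.sym (ℕ.+-∸-assoc e (<⇒≤ i<j)))
            (ℕ.+-∸-comm (toℕ j) i≤e))

    at-multiple : ∀ {m e} → d ∣ m → toℕ i ≤ e → fold x g (m + e) ≈ fold x g e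
    at-multiple (divides q ≡.refl) i≤e = periods q i≤e
      where
      periods : ∀ q {e} → toℕ i ≤ e → fold x g (q * d + e) ≈ fold x g e
      periods zero            i≤e = refl
      periods (suc q) {e}     i≤e = trans
        (reflexive (≡.cong (fold x g) (ℕ.+-assoc d (q * d) e)))
        (trans (one-period (≤-trans i≤e (ℕ.m≤n+m e (q * d)))) (periods q i≤e))

-- Substitution in terms, powers, products and isomorphisms

module _ {σ : Signature} where

  bind : {X Y : Set} → Term σ X → (X → Term σ Y) → Term σ Y
  bind (var x)    s = s x
  bind (app f ts) s = app f (λ k → bind (ts k) s)

  module _ (A : Algebra σ) where
    open Algebra A using (_≈_; refl; interp-cong)

    eval-bind : {X Y : Set} (t : Term σ X) (s : X → Term σ Y) (ρ : Y → Carrier A) →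
                eval A (bind t s) ρ ≈ eval A t (λ x → eval A (s x) ρ)
    eval-bind (var x)    s ρ = refl
    eval-bind (app f ts) s ρ = interp-cong f (λ k → eval-bind (ts k) s ρ)

    pointwise₂ : ∀ {x x′ y y′} → x ≈ x′ → y ≈ y′ → ∀ k → (x ∷ y ∷ []) k ≈ (x′ ∷ y′ ∷ []) k
    pointwise₂ e e′ zero       = e
    pointwise₂ e e′ (suc zero) = e′

    binary-cong : ∀ t {x x′ y y′} → x ≈ x′ → y ≈ y′ → binary A t x y ≈ binary A t x′ y′
    binary-cong t e e′ = eval-cong A t (pointwise₂ e e′)

    eval-idempotent : Idempotent A → {X : Set} (t : Term σ X) → ∀ x → eval A t (λ _ → x) ≈ x
    eval-idempotent idem (var _)    x = refl
    eval-idempotent idem (app f ts) x =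
      Algebra.trans A (interp-cong f (λ k → eval-idempotent idem (ts k) x)) (idem f x)

    binary-idempotent : Idempotent A → ∀ t x → binary A t x x ≈ x
    binary-idempotent idem t x =
      Algebra.trans A (eval-cong A t λ { zero → refl ; (suc zero) → refl }) (eval-idempotent idem t x)

    eval-closed : {B : Pred (Carrier A) 0ℓ} → IsSubuniverse A B → {X : Set} (t : Term σ X) →
                  {ρ : X → Carrier A} → (∀ x → ρ x ∈ B) → eval A t ρ ∈ B
    eval-closed sub (var x)    ρ∈B = ρ∈B x
    eval-closed sub (app f ts) ρ∈B =
      IsSubuniverse.closed sub f _ (λ k → eval-closed sub (ts k) ρ∈B)

    eval-compatible : (θ : Congruence A) → let open Congruence θ in
                      {X : Set} (t : Term σ X) {ρ ρ′ : X → Carrier A} →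
                      (∀ x → ρ x ∼ ρ′ x) → eval A t ρ ∼ eval A t ρ′
    eval-compatible θ (var x)    e = e x
    eval-compatible θ (app f ts) e = Congruence.compatible θ f (λ k → eval-compatible θ (ts k) e)

    power-finite : ∀ {n} → IsFinite (domain A) n → ∀ m →
                   IsFinite (domain (Product {I = Fin m} (λ _ → A))) (n ^ m)
    power-finite finite m = record
      { to        = λ x → funToFin (to ∘ x)
      ; from      = λ k → from ∘ finToFun k
      ; to-cong   = λ e → funToFin-cong (to-cong ∘ e)
      ; from-cong = λ { ≡.refl i → refl }
      ; inverse   =
          (λ {k} e → ≡.trans (funToFin-cong (λ i → inverseˡ (e i))) (funToFin-finToFin {m} k))
        , (λ {x} → λ { ≡.refl i → Algebra.trans A (from-cong (finToFun-funToFin (to ∘ x) i)) (strictlyInverseʳ (x i)) })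
      }
      where
      open Inverse finite
      funToFin-cong : ∀ {m n} {f g : Fin m → Fin n} → (∀ i → f i ≡ g i) → funToFin f ≡ funToFin g
      funToFin-cong {zero}  e = ≡.refl
      funToFin-cong {suc m} e = ≡.cong₂ combine (e zero) (funToFin-cong (e ∘ suc))

  eval-Product : {I : Set} (A : I → Algebra σ) {X : Set} (t : Term σ X) (ρ : X → Carrier (Product A)) →
                 Algebra._≈_ (Product A) (eval (Product A) t ρ) (λ i → eval (A i) t (λ x → ρ x i))
  eval-Product A (var x)    ρ i = Algebra.refl (A i)
  eval-Product A (app f ts) ρ i = Algebra.interp-cong (A i) f (λ k → eval-Product A (ts k) ρ i)

  module _ {A B : Algebra σ} where
    private
      module A = Algebra A
      module B = Algebra B

    ≅-sym : A ≅ B → B ≅ A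
    ≅-sym (h , preserves) = Symmetry.inverse h , λ f xs →
      A.trans (from-cong (B.trans (B.interp-cong f (λ k → B.sym (strictlyInverseˡ (xs k))))
                                  (B.sym (preserves f (from ∘ xs)))))
              (strictlyInverseʳ _)
      where open Inverse h

    eval-≅ : ((h , _) : A ≅ B) {X : Set} (t : Term σ X) (ρ : X → Carrier A) →
             Inverse.to h (eval A t ρ) B.≈ eval B t (Inverse.to h ∘ ρ)
    eval-≅ iso             (var x)    ρ = B.refl
    eval-≅ iso@(_ , preserves) (app f ts) ρ =
      B.trans (preserves f _) (B.interp-cong f (λ k → eval-≅ iso (ts k) ρ))

    binary-≅ : ((h , _) : A ≅ B) → let open Inverse h in
               ∀ t x y → to (binary A t x y) B.≈ binary B t (to x) (to y)
    binary-≅ iso t x y =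
      B.trans (eval-≅ iso t _) (eval-cong B t λ { zero → B.refl ; (suc zero) → B.refl })

    Idempotent-≅ : A ≅ B → Idempotent A → Idempotent B
    Idempotent-≅ (h , preserves) idem f x =
      B.trans (B.interp-cong f (λ _ → B.sym (strictlyInverseˡ x)))
        (B.trans (B.sym (preserves f _)) (B.trans (to-cong (idem f (from x))) (strictlyInverseˡ x)))
      where open Inverse h

    HasSEdge-≅ : A ≅ B → HasSEdge A → HasSEdge B
    HasSEdge-≅ iso@(h , _) (a , b , a≉b , edge) =
      to a , to b , a≉b ∘ to-injective h , record
        { term = term ; aa = image aa ; ab = image ab ; ba = image ba ; bb = image bb }
      where
      open Inverse h
      open _⟶ₛ_ edge
      image : ∀ {x y z} → binary A term x y A.≈ z → binary B term (to x) (to y) B.≈ to z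
      image e = B.trans (B.sym (binary-≅ iso term _ _)) (to-cong e)

-- Deciding the existence of s-edges

module _ {n : ℕ} (A : Algebra (oneOperation n)) {M : ℕ} (finite : IsFinite (domain A) M)
         {m : ℕ} (ρ : Fin m → Carrier A) where
  open Algebra A using (_≈_; trans; sym; interp-cong)
  open Inverse finite

  -- The subuniverse generated by the `ρ j`, presented through terms so that membership carries the
  -- term needed for an s-edge.
  Generated : Pred (Carrier A) 0ℓ
  Generated y = ∃[ u ] eval A u ρ ≈ y

  private
    -- One step of the closure. Tuples over `S` are coded by single numbers `c`, which makes the
    -- search through them finite.
    Produced : Subset M → Pred (Fin M) 0ℓ
    Produced S k =
      (∃[ j ] to (ρ j) ≡ k) ⊎
      (∃[ c ] (∀ i → finToFun {M} {n} c i Subset.∈ S) × to (interp A tt (from ∘ finToFun c)) ≡ k)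

    produced? : ∀ S → Decidable (Produced S)
    produced? S k =
      any? (λ j → to (ρ j) Fin.≟ k) ⊎-dec
      any? (λ c → all? (λ i → finToFun c i ∈? S) ×-dec (to (interp A tt (from ∘ finToFun c)) Fin.≟ k))

    Sound Closed : Pred (Subset M) 0ℓ
    Sound S  = ∀ {k} → k Subset.∈ S → from k ∈ Generated
    Closed S = ∀ {k} → k ∈ Produced S → k Subset.∈ S

    produced-sound : ∀ {S} → Sound S → ∀ {k} → k ∈ Produced S → from k ∈ Generated
    produced-sound sound (inj₁ (j , ≡.refl)) = var j , sym (strictlyInverseʳ (ρ j))
    produced-sound sound (inj₂ (c , c∈S , ≡.refl)) =
      app tt (λ i → proj₁ (sound (c∈S i))) ,
      trans (interp-cong tt (λ i → proj₂ (sound (c∈S i)))) (sym (strictlyInverseʳ _))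

    -- Missing `Produced` codes are added one at a time. Subsets of a finite set admit no infinite
    -- strictly ascending chain, and the process stops only at a closed set.
    saturate : ∀ S → Acc Subset._⊃_ S → Sound S → ∃[ S′ ] Sound S′ × Closed S′
    saturate S (acc rec) sound with any? (λ k → produced? S k ×-dec ¬? (k ∈? S))
    ... | no closed = S , sound , λ {k} k∈P → decidable-stable (k ∈? S) (λ k∉S → closed (k , k∈P , k∉S))
    ... | yes (k , k∈P , k∉S) =
      saturate (S ∪ ⁅ k ⁆) (rec (p⊆p∪q ⁅ k ⁆ , k , q⊆p∪q S ⁅ k ⁆ (x∈⁅x⁆ k) , k∉S)) sound′
      where
      sound′ : Sound (S ∪ ⁅ k ⁆)
      sound′ {j} j∈ with x∈p∪q⁻ S ⁅ k ⁆ j∈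
      ... | inj₁ j∈S = sound j∈S
      ... | inj₂ j∈k = ≡.subst (λ j → from j ∈ Generated) (≡.sym (x∈⁅y⁆⇒x≡y k j∈k)) (produced-sound sound k∈P)

    -- Induction on the term: the codes of the values of the subterms form a tuple over `S`, to
    -- which closedness applies.
    complete : ∀ {S} → Closed S → ∀ u → to (eval A u ρ) Subset.∈ S
    complete closed (var j) = closed (inj₁ (j , ≡.refl))
    complete {S} closed (app tt us) = closed (inj₂
      ( funToFin code
      , (λ i → ≡.subst (Subset._∈ S) (≡.sym (finToFun-funToFin code i)) (complete closed (us i)))
      , to-cong (interp-cong tt λ i →
          trans (from-cong (finToFun-funToFin code i)) (strictlyInverseʳ _))))
      where
      code : Fin n → Fin M
      code i = to (eval A (us i) ρ)

  -- Soundness and closedness bound the saturated set from both sides, so membership in it decides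
  -- `Generated`. The empty set is a vacuously sound start.
  generated? : Decidable Generated
  generated? y with saturate Subset.⊥ (⊃-wellFounded Subset.⊥) (λ k∈⊥ → contradiction k∈⊥ ∉⊥)
  ... | S , sound , closed = Dec.map′
    (λ k∈S → let u , e = sound k∈S in u , trans e (strictlyInverseʳ y))
    (λ (u , e) → ≡.subst (Subset._∈ S) (to-cong e) (complete closed u))
    (to y ∈? S)

module _ {σ : Signature} (A : Algebra σ) {n : ℕ} (t : Term σ (Fin n)) where
  open Algebra A using (_≈_; refl; sym; trans; interp-cong)

  expand : {X : Set} → Term (oneOperation n) X → Term σ X
  expand (var x)    = var x
  expand (app _ us) = bind t (λ k → expand (us k))

  eval-expand : {X : Set} (u : Term (oneOperation n) X) (ρ : X → Carrier A) →
                eval A (expand u) ρ ≈ eval (termReduct A t) u ρ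
  eval-expand (var x)    ρ = refl
  eval-expand (app _ us) ρ =
    trans (eval-bind A t _ ρ) (eval-cong A t (λ k → eval-expand (us k) ρ))

  module _ (idem : Idempotent A) (generates : GeneratesClone A t)
           {N : ℕ} (finite : IsFinite (domain A) N) where

    private
      -- The signature may have infinitely many operations. Since `t` generates the clone, passing
      -- to its reduct keeps the subalgebras of the square and leaves one operation to close under.
      reduct² : Algebra (oneOperation n)
      reduct² = Product {I = Fin 2} (λ _ → termReduct A t)

      finite² : IsFinite (domain reduct²) (N ^ 2)
      finite² = power-finite (termReduct A t) finite 2

      -- a ⟶ₛ b holds iff (b , b) lies in the subalgebra of A² generated by (a , b) and (b , a).
      module _ (a b : Carrier A) where
        gens : Fin 2 → Carrier reduct²
        gens k zero       = (a ∷ b ∷ []) k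
        gens k (suc zero) = (b ∷ a ∷ []) k

        edge⇒generated : _⟶ₛ_ A a b → Generated reduct² finite² gens (λ _ → b)
        edge⇒generated edge = u , λ
          { zero       → trans (eval-Product (λ _ → termReduct A t) u gens zero) (trans (u≈ _) ab)
          ; (suc zero) → trans (eval-Product (λ _ → termReduct A t) u gens (suc zero)) (trans (u≈ _) ba) }
          where
          open _⟶ₛ_ edge
          u  = proj₁ (generates term)
          u≈ = proj₂ (generates term)

        generated⇒edge : Generated reduct² finite² gens (λ _ → b) → _⟶ₛ_ A a b
        generated⇒edge (u , e) = record
          { term = expand u
          ; aa   = binary-idempotent A idem (expand u) a
          ; ab   = value zero
          ; ba   = value (suc zero)
          ; bb   = binary-idempotent A idem (expand u) b
          }
          where
          value : ∀ i → eval A (expand u) (λ k → gens k i) ≈ b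
          value i = trans (eval-expand u _) (trans (sym (eval-Product (λ _ → termReduct A t) u gens i)) (e i))

    sEdge? : ∀ a b → Dec (_⟶ₛ_ A a b)
    sEdge? a b = Dec.map′ (generated⇒edge a b) (edge⇒generated a b)
      (generated? reduct² finite² (gens a b) (λ _ → b))

    hasSEdge? : Dec (HasSEdge A)
    hasSEdge? = Dec.map′
      (λ (i , j , a≉b , edge) → from i , from j , a≉b , edge)
      (λ (a , b , a≉b , edge) → to a , to b ,
        (λ e → a≉b (trans (sym (strictlyInverseʳ a)) (trans e (strictlyInverseʳ b)))) ,
        resp (sym (strictlyInverseʳ a)) (sym (strictlyInverseʳ b)) edge)
      (any? λ i → any? λ j → ¬? (finite-≟ finite (from i) (from j)) ×-dec sEdge? (from i) (from j))
      where
      open Inverse finite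
      resp : ∀ {a a′ b b′} → a ≈ a′ → b ≈ b′ → _⟶ₛ_ A a b → _⟶ₛ_ A a′ b′
      resp {a} {a′} {b} {b′} ea eb edge = record
        { term = term
        ; aa = move ea ea ea aa ; ab = move ea eb eb ab ; ba = move eb ea eb ba ; bb = move eb eb eb bb }
        where
        open _⟶ₛ_ edge
        move : ∀ {x x′ y y′ z z′} → x ≈ x′ → y ≈ y′ → z ≈ z′ → binary A term x y ≈ z → binary A term x′ y′ ≈ z′
        move ex ey ez e = trans (binary-cong A term (sym ex) (sym ey)) (trans e ez)

-- Terms acting as the first projection on the classes of a central monolith

module _ {σ : Signature} where

  infixl 8 _⟨_,_⟩
  _⟨_,_⟩ : Term σ (Fin 2) → Term σ (Fin 2) → Term σ (Fin 2) → Term σ (Fin 2)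
  t ⟨ u , v ⟩ = bind t (u ∷ v ∷ [])

  x₀ x₁ : Term σ (Fin 2)
  x₀ = var zero
  x₁ = var (suc zero)

  iterated : Term σ (Fin 2) → ℕ → Term σ (Fin 2)
  iterated t = fold x₁ (λ u → t ⟨ x₀ , u ⟩)

  straightened : Term σ (Fin 2) → ℕ → Term σ (Fin 2)
  straightened t k = let u = iterated t k in u ⟨ x₀ , u ⟨ x₁ , x₀ ⟩ ⟩

  module _ (A : Algebra σ) where
    open Algebra A using (_≈_; refl; sym; trans; reflexive)

    binary-⟨⟩ : ∀ t u v x y → binary A (t ⟨ u , v ⟩) x y ≈ binary A t (binary A u x y) (binary A v x y)
    binary-⟨⟩ t u v x y =
      trans (eval-bind A t _ _) (eval-cong A t λ { zero → refl ; (suc zero) → refl })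

    binary-iterated : ∀ t k x y → binary A (iterated t k) x y ≈ fold y (binary A t x) k
    binary-iterated t zero    x y = refl
    binary-iterated t (suc k) x y =
      trans (binary-⟨⟩ t x₀ (iterated t k) x y) (binary-cong A t refl (binary-iterated t k x y))

    binary-straightened : ∀ t k x y → let u = binary A (iterated t k) in
                          binary A (straightened t k) x y ≈ u x (u y x)
    binary-straightened t k x y = let u = iterated t k in
      trans (binary-⟨⟩ u x₀ (u ⟨ x₁ , x₀ ⟩) x y) (binary-cong A u refl (binary-⟨⟩ u x₁ x₀ x y))

    module _ {B C : Pred (Carrier A) 0ℓ} (B-resp : ∀ {x y} → x ≈ y → x ∈ B → y ∈ B)
             (B⊆C : ∀ {x} → x ∈ B → x ∈ C) where

      -- Absorption relative to a range `C` of arguments. With `B` the class of `b` and `C` that of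
      -- `a` and `b` it captures a semilattice edge; with `C` everything it is binary absorption.
      AbsorbsIn : Term σ (Fin 2) → Set
      AbsorbsIn t = ∀ {x y} → x ∈ C → y ∈ C → x ∈ B ⊎ y ∈ B → binary A t x y ∈ B

      -- The innermost application lands in `B`, and every further one has an argument in `B`. The
      -- exponent must be nonzero, as zero iterations return `y`, which may lie outside `B`.
      iterated-absorbs : ∀ t → AbsorbsIn t → ∀ k .{{_ : NonZero k}} → AbsorbsIn (iterated t k)
      iterated-absorbs t absorbs k {x} {y} x∈C y∈C x∈B⊎y∈B =
        B-resp (sym (binary-iterated t k x y)) (iterate k)
        where
        iterate : ∀ k .{{_ : NonZero k}} → fold y (binary A t x) k ∈ B
        iterate (suc zero)      = absorbs x∈C y∈C x∈B⊎y∈B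
        iterate (suc k@(suc _)) = absorbs x∈C (B⊆C (iterate k)) (inj₂ (iterate k))

      -- The inner value `u y x` is already in `B`, whichever argument was, and the outer `u` then
      -- absorbs it.
      straightened-absorbs : ∀ t → AbsorbsIn t → ∀ k .{{_ : NonZero k}} → AbsorbsIn (straightened t k)
      straightened-absorbs t absorbs k x∈C y∈C x∈B⊎y∈B =
        B-resp (sym (binary-straightened t k _ _)) (u-absorbs x∈C (B⊆C inner) (inj₂ inner))
        where
        u-absorbs : AbsorbsIn (iterated t k)
        u-absorbs = iterated-absorbs t absorbs k
        inner = u-absorbs y∈C x∈C (swap x∈B⊎y∈B)

    module _ (idem : Idempotent A) (si : SubdirectlyIrreducible A) where
      open SubdirectlyIrreducible si using (monolith)
      open Congruence monolith using () renaming (_∼_ to _μ_)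
      open Congruence (factorCongruence si) using () renaming (_∼_ to _≋_)
      private module μ = IsEquivalence (Congruence.isEquivalence monolith)

      -- This is the centralizer condition with one variable of each sort, `t′` being `t` with its
      -- variables sorted. The first sort ranges over the full congruence, so `x` and `y` are
      -- arbitrary.
      centralizes₂ : LargeCentralizer si → ∀ t {x y c d} → c μ d →
                     binary A t x c ≈ binary A t x d → binary A t y c ≈ binary A t y d
      centralizes₂ large t {x} {y} {c} {d} cμd e =
        trans (sym (split y c))
          (trans (large t′ (x ∷ []) (y ∷ []) (c ∷ []) (d ∷ []) (λ _ → tt) (λ { zero → cμd })
                   (trans (split x c) (trans e (sym (split x d)))))
                 (split y d))
        where
        t′ : Term σ (Fin 1 ⊎ Fin 1)
        t′ = bind t (var (inj₁ zero) ∷ var (inj₂ zero) ∷ [])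
        split : ∀ x c → eval A t′ [ x ∷ [] , c ∷ [] ]′ ≈ binary A t x c
        split x c = trans (eval-bind A t _ _) (eval-cong A t λ { zero → refl ; (suc zero) → refl })

      module _ {n N : ℕ} (n≤N : n ≤ N) (finite : IsFinite (domain A) n) where

        -- Write u for iterated t (N !), so that u x (u x y) ≈ u x y.  If x μ y then u x y μ y,
        -- and centrality lets the outer x be changed to y: u y (u x y) ≈ u y y ≈ y.
        straightened-first : LargeCentralizer si → ∀ t {x y} → x μ y →
                             binary A (straightened t (N !)) x y ≈ x
        straightened-first large t {x} {y} xμy =
          trans (binary-straightened t (N !) x y)
            (trans (centralizes₂ large u uyxμx stable) (binary-idempotent A idem u x))
          where
          u = iterated t (N !)

          stable : binary A u y (binary A u y x) ≈ binary A u y x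
          stable = trans (binary-cong A u refl (binary-iterated t (N !) y x))
            (trans (binary-iterated t (N !) y _)
            (trans (fold-!-idempotent finite n≤N (binary A t y) (binary-cong A t refl) x)
                   (sym (binary-iterated t (N !) y x))))

          uyxμx : binary A u y x μ x
          uyxμx = μ.trans
            (eval-compatible A monolith u λ { zero → μ.sym xμy ; (suc zero) → μ.refl })
            (Congruence.reflexive monolith (binary-idempotent A idem u x))

        -- In the central case `straightened-first` gives the value `c` at `(c , c)` and at
        -- `(c , d)`. Centrality carries this equality from first argument `c` to first argument
        -- `x`.
        straightened-second : ∀ t {x c d} → c ≋ d →
          binary A (straightened t (N !)) x c ≈ binary A (straightened t (N !)) x d
        straightened-second t (inj₁ c≈d) = binary-cong A (straightened t (N !)) refl c≈d
        straightened-second t {x} {c} {d} (inj₂ (large , cμd)) =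
          centralizes₂ large (straightened t (N !)) cμd
            (trans (straightened-first large t μ.refl) (sym (straightened-first large t cμd)))

-- Retractive consistent sets of maps

module _ {σ : Signature} (A : Algebra σ) where
  open Algebra A using (_≈_; refl; sym; trans)

  identity-polynomial : IsUnaryPolynomial A id
  identity-polynomial = 0 , var zero , [] , λ _ → refl

  ∘-polynomial : ∀ {p q} → IsUnaryPolynomial A p → IsUnaryPolynomial A q → IsUnaryPolynomial A (p ∘ q)
  ∘-polynomial {p} {q} p-poly@(m , t , c , p≈) (n , u , d , q≈) =
    m + n , bind t s , c Vector.++ d , λ x →
      trans (p≈ (q x)) (trans (eval-cong A t (values x)) (sym (eval-bind A t s _)))
    where
    -- The parameters of `q` are placed after the `m` parameters of `p`; the argument keeps position
    -- zero.
    lift : Fin (suc n) → Term σ (Fin (suc (m + n)))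
    lift zero    = var zero
    lift (suc k) = var (suc (m ↑ʳ k))

    s : Fin (suc m) → Term σ (Fin (suc (m + n)))
    s zero    = bind u lift
    s (suc k) = var (suc (k ↑ˡ n))

    values : ∀ x k → (q x ∷ c) k ≈ eval A (s k) (x ∷ (c Vector.++ d))
    values x zero = trans (q≈ x) (trans (eval-cong A u constants) (sym (eval-bind A u lift _)))
      where
      constants : ∀ k → (x ∷ d) k ≈ eval A (lift k) (x ∷ (c Vector.++ d))
      constants zero    = refl
      constants (suc k) = Algebra.reflexive A (≡.sym (lookup-++ʳ c d k))
    values x (suc k) = Algebra.reflexive A (≡.sym (lookup-++ˡ c d k))

  NotOnto : (Carrier A → Carrier A) → Set
  NotOnto p = ∃[ a ] ¬ InImage A p a

  -- For idempotent maps this is exchanged with `NotOnto` below. Unlike a missed point, a collapsed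
  -- pair visibly survives when another map is applied afterwards.
  Collapses : (Carrier A → Carrier A) → Set
  Collapses p = ∃[ a ] ∃[ b ] ¬ (a ≈ b) × p a ≈ p b

  fold-collapses : ∀ {g} → (∀ {x y} → x ≈ y → g x ≈ g y) → ∀ k .{{_ : NonZero k}} →
                   Collapses g → Collapses (λ x → fold x g k)
  fold-collapses {g} g-cong k (a , b , a≉b , e) = a , b , a≉b , go k
    where
    go : ∀ k .{{_ : NonZero k}} → fold a g k ≈ fold b g k
    go (suc zero)      = e
    go (suc k@(suc _)) = g-cong (go k)

  module _ {e : Carrier A → Carrier A} (e-cong : ∀ {x y} → x ≈ y → e x ≈ e y) (e-idem : IdempotentMap A e) where

    fixes-image : ∀ {y} → InImage A e y → e y ≈ y
    fixes-image (x , ex≈y) = trans (e-cong (sym ex≈y)) (trans (e-idem x) ex≈y)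

    -- A missed point differs from its image, yet idempotence sends both to the same place.
    notOnto⇒collapses : NotOnto e → Collapses e
    notOnto⇒collapses (a , a∉) = a , e a , (λ a≈ea → a∉ (a , sym a≈ea)) , sym (e-idem a)

    -- The image of an idempotent map consists of its fixed points, and two distinct points with
    -- equal images cannot both be fixed.
    collapses⇒notOnto : (∀ x y → Dec (x ≈ y)) → Collapses e → NotOnto e
    collapses⇒notOnto _≟_ (a , b , a≉b , ea≈eb) with e a ≟ a
    ... | no  ea≉a = a , ea≉a ∘ fixes-image
    ... | yes ea≈a = b , λ b∈ → a≉b (trans (sym ea≈a) (trans ea≈eb (fixes-image b∈)))

module _ {σ : Signature} (P : Instance σ) where
  open Instance P

  Maps : Set
  Maps = ∀ i → Carrier (dom i) → Carrier (dom i)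

  id-consistent : Consistent P (λ _ → id)
  id-consistent = record
    { polynomial = λ i → identity-polynomial (dom i)
    ; preserves  = All.universal (λ _ _ r∈R → r∈R) constraints
    }

  ∘-consistent : ∀ {p q} → Consistent P p → Consistent P q → Consistent P (λ i → p i ∘ q i)
  ∘-consistent p-cons q-cons = record
    { polynomial = λ i → ∘-polynomial (dom i) (polynomial p-cons i) (polynomial q-cons i)
    ; preserves  = All.zipWith (λ (f , g) r r∈R → f _ (g r r∈R)) (preserves p-cons , preserves q-cons)
    }
    where open Consistent

  fold-consistent : ∀ {p} → Consistent P p → ∀ k → Consistent P (λ i x → fold x (p i) k)
  fold-consistent p-cons zero    = id-consistent
  fold-consistent p-cons (suc k) = ∘-consistent p-cons (fold-consistent p-cons k)

  consistent-cong : ∀ {p} → Consistent P p → ∀ i {x y} →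
                    Algebra._≈_ (dom i) x y → Algebra._≈_ (dom i) (p i x) (p i y)
  consistent-cong p-cons i = polynomial-cong (dom i) (Consistent.polynomial p-cons i)

  consistent-solution : ∀ {p f} → Consistent P p → f ∈ Solution P → (λ i → p i (f i)) ∈ Solution P
  consistent-solution p-cons f-sol =
    All.zipWith (λ (preserved , f∈R) → preserved _ f∈R) (Consistent.preserves p-cons , f-sol)

  module _ {N : ℕ} (finite : ∀ i → Σ[ n ∈ ℕ ] n ≤ N × IsFinite (domain (dom i)) n) where

    private instance
      N!≢0 : NonZero (N !)
      N!≢0 = N !≢0

    _≟ᵈ_ : ∀ {i} (x y : Carrier (dom i)) → Dec (Algebra._≈_ (dom i) x y)
    _≟ᵈ_ {i} = finite-≟ (proj₂ (proj₂ (finite i)))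

    -- All coordinates must be iterated equally often to stay consistent. The exponent `N !` serves
    -- every domain at once because `N` bounds all sizes.
    fold-retractive : ∀ {p} → Consistent P p → Retractive P (λ i x → fold x (p i) (N !))
    fold-retractive {p} p-cons i = let n , n≤N , fin = finite i in
      fold-!-idempotent fin n≤N (p i) (consistent-cong p-cons i)

    NotOntoAt : Maps → Pred (Fin variables) 0ℓ
    NotOntoAt p i = NotOnto (dom i) (p i)

    fold-notOnto : ∀ {p} → Consistent P p → ∀ i → Collapses (dom i) (p i) →
                   NotOntoAt (λ i x → fold x (p i) (N !)) i
    fold-notOnto {p} p-cons i c = collapses⇒notOnto (dom i)
      (consistent-cong (fold-consistent p-cons (N !)) i) (fold-retractive p-cons i) _≟ᵈ_
      (fold-collapses (dom i) (consistent-cong p-cons i) (N !) c)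

    -- The composite is iterated to regain idempotence. A point missed by `p i` stays missed because
    -- `p i` is applied last; a pair collapsed by `q i` stays collapsed, and so yields a missed
    -- point.
    retract-∘ : ∀ {p q} → Consistent P p → Retractive P p → Consistent P q → Retractive P q →
      ∃[ r ] Consistent P r × Retractive P r ×
        (∀ i → NotOntoAt p i ⊎ NotOntoAt q i → NotOntoAt r i)
    retract-∘ {p} {q} p-cons p-retr q-cons q-retr =
      (λ i x → fold x (p i ∘ q i) (N !)) , fold-consistent pq-cons (N !) , fold-retractive pq-cons , notOnto
      where
      pq-cons = ∘-consistent p-cons q-cons

      notOnto : ∀ i → NotOntoAt p i ⊎ NotOntoAt q i → NotOntoAt (λ i x → fold x (p i ∘ q i) (N !)) i
      notOnto i (inj₁ (a , a∉)) = a , λ (x , e) → a∉ (image (N !) x e)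
        where
        image : ∀ k .{{_ : NonZero k}} x → Algebra._≈_ (dom i) (fold x (p i ∘ q i) k) a → InImage (dom i) (p i) a
        image (suc k) x e = q i (fold x (p i ∘ q i) k) , e
      notOnto i (inj₂ q-notOnto) = fold-notOnto pq-cons i
        (let a , b , a≉b , e = notOnto⇒collapses (dom i) (consistent-cong q-cons i) (q-retr i) q-notOnto
         in a , b , a≉b , consistent-cong p-cons i e)

    module _ (E : Pred (Fin variables) 0ℓ)
             (retract : ∀ i → ∃[ p ] Consistent P p × Retractive P p × (E i → NotOntoAt p i)) where

      retract-all : ∀ is → ∃[ p ] Consistent P p × Retractive P p × All (λ i → E i → NotOntoAt p i) is
      retract-all List.[] = (λ _ → id) , id-consistent , (λ i _ → Algebra.refl (dom i)) , All.[]
      retract-all (i List.∷ is) with retract i | retract-all is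
      ... | p , p-cons , p-retr , at-i | q , q-cons , q-retr , at-is
        with retract-∘ p-cons p-retr q-cons q-retr
      ... | r , r-cons , r-retr , combine = r , r-cons , r-retr ,
        ((λ e → combine i (inj₁ (at-i e))) All.∷ All.map (λ at-j e → combine _ (inj₂ (at-j e))) at-is)

    -- Consistent maps obtained from solutions of the factored instance

    module _ (idem : ∀ i → Idempotent (dom i)) (si : SIInstance P) where

      module _ (t : Term σ (Fin 2)) {f : ∀ i → Carrier (dom i)} (f-sol : f ∈ Solution (P /μ̄ si)) where

        translation : Maps
        translation i x = binary (dom i) (straightened t (N !)) x (f i)

        -- A solution through `b` in the factored instance has value `b` at `i` only up to the
        -- factor congruence; `straightened-second` makes the difference invisible.
        translation-≋ : ∀ i {b} → Congruence._∼_ (factorCongruence (si i)) (f i) b → ∀ x →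
                        Algebra._≈_ (dom i) (translation i x) (binary (dom i) (straightened t (N !)) x b)
        translation-≋ i f≋b x = let n , n≤N , fin = finite i in
          straightened-second (dom i) (idem i) (si i) n≤N fin t f≋b

        -- A constraint only contains some s ≋ f rather than f itself, but translating by s
        -- is the same as translating by f.
        translation-consistent : Consistent P translation
        translation-consistent = record
          { polynomial = λ i → 1 , straightened t (N !) , f i ∷ [] , λ _ → Algebra.refl (dom i)
          ; preserves  = All.map (λ {C} → preserved C) (All.map⁻ f-sol)
          }
          where
          preserved : ∀ C → let open Constraint C in
            f ∘ proj₁ ∈ Constraint.relation (factorConstraint (λ i → factorCongruence (si i)) C) →
            ∀ r → r ∈ relation → (λ i → translation (proj₁ i) (r i)) ∈ relation
          preserved C (s , s∈R , s≋f) r r∈R = IsSubuniverse.respects isSubuniverse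
            translated
            (eval-closed (Scoped dom scope) isSubuniverse (straightened t (N !))
              λ { zero → r∈R ; (suc zero) → s∈R })
            where
            open Constraint C

            translated : ∀ i → Algebra._≈_ (dom (proj₁ i))
              (eval (Scoped dom scope) (straightened t (N !)) (r ∷ s ∷ []) i)
              (translation (proj₁ i) (r i))
            translated i = trans (eval-Product (dom ∘ proj₁) (straightened t (N !)) (r ∷ s ∷ []) i)
              (trans (eval-cong (dom (proj₁ i)) (straightened t (N !)) λ { zero → refl ; (suc zero) → refl })
                     (straightened-second (dom (proj₁ i)) (idem _) (si _) n≤N fin t (s≋f i)))
              where
              open Algebra (dom (proj₁ i))
              n≤N = proj₁ (proj₂ (finite (proj₁ i)))
              fin = proj₂ (proj₂ (finite (proj₁ i)))

      module _ (solvable : SolutionThroughEveryPoint (P /μ̄ si)) where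

        -- Translating by a solution through the absorbing end `b` sends both ends of the edge to
        -- `b`; iteration turns this collapse into a missed point.
        retract-sEdge : ∀ i → HasSEdge (dom i) →
          ∃[ p ] Consistent P p × Retractive P p × NotOntoAt p i
        retract-sEdge i (a , b , a≉b , edge) with solvable i b
        ... | f , f-sol , f≋b =
          (λ i x → fold x (p i) (N !)) , fold-consistent p-cons (N !) , fold-retractive p-cons ,
          fold-notOnto p-cons i
            (a , b , a≉b , trans (to-b (inj₁ refl)) (sym (to-b (inj₂ refl))))
          where
          open Algebra (dom i)
          open _⟶ₛ_ edge
          p = translation term f-sol
          p-cons = translation-consistent term f-sol

          semilattice : AbsorbsIn (dom i) {_≈ b} {λ x → x ≈ a ⊎ x ≈ b} (λ e → trans (sym e)) inj₂ term
          semilattice (inj₁ ex) _         (inj₂ ey) = trans (binary-cong (dom i) term ex ey) ab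
          semilattice (inj₂ ex) _         (inj₂ ey) = trans (binary-cong (dom i) term ex ey) bb
          semilattice _         (inj₁ ey) (inj₁ ex) = trans (binary-cong (dom i) term ex ey) ba
          semilattice _         (inj₂ ey) (inj₁ ex) = trans (binary-cong (dom i) term ex ey) bb

          to-b : ∀ {x} → x ≈ a ⊎ x ≈ b → p i x ≈ b
          to-b x∈ = trans (translation-≋ term f-sol i f≋b _)
            (straightened-absorbs (dom i) (λ e → trans (sym e)) inj₂ term semilattice (N !) x∈ (inj₂ refl) (inj₂ refl))

        retract-sEdges : (∀ i → Dec (HasSEdge (dom i))) →
          ∃[ p ] Consistent P p × Retractive P p × (∀ i → HasSEdge (dom i) → NotOntoAt p i)
        retract-sEdges hasSEdge? =
          let p , p-cons , p-retr , at = retract-all (HasSEdge ∘ dom) step (allFin variables)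
          in p , p-cons , p-retr , λ i → All.lookup at (∈-allFin i)
          where
          step : ∀ i → ∃[ p ] Consistent P p × Retractive P p × (HasSEdge (dom i) → NotOntoAt p i)
          step i with hasSEdge? i
          ... | yes e = let p , p-cons , p-retr , at-i = retract-sEdge i e in p , p-cons , p-retr , λ _ → at-i
          -- Without an s-edge the requirement is vacuous, so the identity serves.
          ... | no ¬e = (λ _ → id) , id-consistent , (λ i _ → Algebra.refl (dom i)) , λ e → contradiction e ¬e

        -- A translation by a solution through a point of `B` is consistent, so it moves the given
        -- solution `g` to a solution; absorption puts the new value at `i` into `B`.
        absorbed-solution : ∀ i {B} → BinaryAbsorbing (dom i) B → ∃[ f ] f ∈ Solution P →
                            ∃[ f ] f ∈ Solution P × f i ∈ B
        absorbed-solution i {B} absorbing (g , g-sol) with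
          IsSubuniverse.nonempty (BinaryAbsorbing.isSubuniverse absorbing)
        ... | b , b∈B with solvable i b
        ... | f , f-sol , f≋b =
          (λ j → translation term f-sol j (g j)) ,
          consistent-solution (translation-consistent term f-sol) g-sol ,
          respects (Algebra.sym (dom i) (translation-≋ term f-sol i f≋b (g i)))
            (straightened-absorbs (dom i) {C = λ _ → ⊤} respects _
              term (λ _ _ → absorbs _ _) (N !) tt tt (inj₂ b∈B))
          where
          open BinaryAbsorbing absorbing
          open IsSubuniverse isSubuniverse

-- A common size bound, and transport from the template to the instance

upperBound : ∀ {n} (f : Fin n → ℕ) → ∃[ N ] ∀ i → f i ≤ N
upperBound {zero}  f = 0 , λ ()
upperBound {suc n} f with upperBound (f ∘ suc)
... | N , f≤N = f zero ⊔ N , λ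
  { zero    → ℕ.m≤m⊔n (f zero) N
  ; (suc i) → ℕ.m≤n⇒m≤o⊔n (f zero) (f≤N i) }

theorem42 : ∀ {σ : Signature} {ℓ : Level} (T : Pred (FiniteAlgebra σ) ℓ) →
    IsMTemplate T →
    (∀ {A} → A ∈ T → MinimalTaylor (FiniteAlgebra.algebra A)) →
    (P : Instance σ) → P IsInstanceOfCSP T → (si : SIInstance P) →
    SolutionThroughEveryPoint (P /μ̄ si) →
    let open Instance P in
    (∃[ p ] Consistent P p × Retractive P p ×
      (∀ i → LargeCentralizer (si i) → HasSEdge (dom i) →
        ∃[ a ] ¬ InImage (dom i) (p i) a))
    ×
    (∀ i → LargeCentralizer (si i) →
      (B : Pred (Algebra.Carrier (dom i)) 0ℓ) → Decidable B → BinaryAbsorbing (dom i) B →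
      (∃[ f ] f ∈ Solution P) ⇔ (∃[ f ] f ∈ Solution P × f i ∈ B))
theorem42 T _ minimalTaylor P inCSP si solvable =
  (let p , p-cons , p-retr , notOnto = retract-sEdges P finite idem si solvable sEdge
   in p , p-cons , p-retr , λ i _ → notOnto i) ,
  (λ i _ B _ absorbing → mk⇔
    (absorbed-solution P finite idem si solvable i absorbing)
    (λ (f , f-sol , _) → f , f-sol))
  where
  open Instance P
  open _IsInstanceOfCSP_ inCSP

  alg : Fin variables → FiniteAlgebra _
  alg i = proj₁ (domains i)

  module alg i = FiniteAlgebra (alg i)

  iso : ∀ i → dom i ≅ alg.algebra i
  iso i = proj₂ (proj₂ (domains i))

  bound = upperBound alg.size

  finite : ∀ i → Σ[ n ∈ ℕ ] n ≤ proj₁ bound × IsFinite (domain (dom i)) n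
  finite i = alg.size i , proj₂ bound i , Composition.inverse (proj₁ (iso i)) (alg.enumeration i)

  iso⁻¹ : ∀ i → alg.algebra i ≅ dom i
  iso⁻¹ i = ≅-sym {A = dom i} {B = alg.algebra i} (iso i)

  idem : ∀ i → Idempotent (dom i)
  idem i = Idempotent-≅ {A = alg.algebra i} {B = dom i} (iso⁻¹ i) (alg.idempotent i)

  -- Minimality makes any Taylor term generate the clone, so s-edges can be decided in the template
  -- algebra; the answer is carried along the isomorphism.
  sEdge : ∀ i → Dec (HasSEdge (dom i))
  sEdge i = let _ , t , t-taylor = hasTaylorTerm in
    Dec.map′ (HasSEdge-≅ (iso⁻¹ i)) (HasSEdge-≅ (iso i))
      (hasSEdge? (alg.algebra i) t (alg.idempotent i) (minimal t t-taylor) (alg.enumeration i))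
    where open MinimalTaylor (minimalTaylor (proj₁ (proj₂ (domains i))))
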